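{- For every positive integer $c$, there exists a positive integer $n(c)$ such that the $n(c)$-Mycielski graph $M_{n(c)}$ has path-chromatic number larger than $c$.
   Context: Graphs are finite and simple. A path-decomposition of a graph $G$ is a sequence $B_1,\dots,B_s$ of subsets of $V(G)$ (bags) such that $V(G)=\bigcup_t B_t$; for each $uv\in E(G)$ there is $t$ with $u,v\in B_t$; and for each $v\in V(G)$ the sets $B_t$ containing $v$ are consecutive in the sequence. The chromatic number of a path-decomposition is $\max_t \chi(G[B_t])$. The path-chromatic number $\chi_P(G)$ is the minimum chromatic number over all path-decompositions of $G$. For $k\ge 2$, the $k$-Mycielski graph $M_k$ is the graph with $3\cdot 2^{k-2}-1$ vertices constructed recursively as follows. $M_2$ is a single edge (on two vertices). For $k\ge 3$, let $v_1,\dots,v_{N}$ with $N=3\cdot 2^{k-3}-1$ be the vertices of $M_{k-1}$; $M_k$ is obtained from $M_{k-1}$ by adding new vertices $w,u_1,\dots,u_N$, the edges $wu_i$ for all $i$, and the edges $u_iv_j$ for all $i\ne j$ such that $v_iv_j\in E(M_{k-1})$. -}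

module Defs where

open import Data.Bool using (true; false)
open import Data.Empty using (⊥-elim)
open import Data.Fin as Fin using (Fin; zero; suc; splitAt; punchIn; punchOut)
open import Data.Fin.Properties as Finₚ using (any?; all?; injective⇒≤; punchIn-punchOut; punchIn-mono-≤; ¬∀⟶∃¬)
open import Data.Fin.Subset using (Subset; _∈_; ∣_∣; ⊤)
open import Data.Fin.Subset.Properties using (_∈?_; anySubset?; ∈⊤)
open import Data.Nat using (ℕ; zero; suc; _+_; _*_; _∸_; _^_; _≤_; _<_; _⊔_; z≤n; s≤s; _≤?_)
open import Data.Nat.Properties using (≤-refl; ≤-trans; ≤-antisym; ≤-pred; ≤-reflexive; <⇒≱; ≰⇒>; n≤1+n; m≤m⊔n; m≤n⊔m; ⊔-lub; m≤n⇒m<n∨m≡n; anyUpTo?; +-suc; +-identityʳ)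
open import Data.Product using (Σ; ∃; _×_; _,_; proj₁; proj₂)
open import Data.Sum using (inj₁; inj₂)
open import Data.Vec using ([]; _∷_)
import Data.Vec.Functional as Vector
open import Function using (_∘_; id)
open import Relation.Binary.PropositionalEquality using (_≡_; _≢_; _≗_; refl; sym; trans; cong; subst; module ≡-Reasoning)
open import Relation.Nullary using (¬_; Dec; yes; no)
open import Relation.Nullary.Decidable using (map′; ¬?; _×-dec_; _→-dec_)
open import Relation.Unary using (Decidable)

record Graph (n : ℕ) : Set₁ where
  infix 4 _~_ _~?_
  field
    _~_      : Fin n → Fin n → Set
    _~?_     : ∀ i j → Dec (i ~ j)
    ~-sym    : ∀ {i j} → i ~ j → j ~ i
    ~-irrefl : ∀ {i} → ¬ (i ~ i)

-- The increasing enumeration of the elements of a subset.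
element : ∀ {n} (B : Subset n) → Fin ∣ B ∣ → Fin n
element (true  ∷ B) zero    = zero
element (true  ∷ B) (suc i) = suc (element B i)
element (false ∷ B) i       = suc (element B i)

-- The induced subgraph, its vertices relabelled increasingly as Fin ∣ B ∣.
infix 8 _[_]
_[_] : ∀ {n} → Graph n → (B : Subset n) → Graph ∣ B ∣
G [ B ] = record
  { _~_      = λ i j → element B i ~ element B j
  ; _~?_     = λ i j → element B i ~? element B j
  ; ~-sym    = ~-sym
  ; ~-irrefl = ~-irrefl
  } where open Graph G

Minimum : (ℕ → Set) → ℕ → Set
Minimum P m = P m × (∀ {k} → P k → m ≤ k)

minimum : ∀ {P} → Decidable P → ∃ P → ∃ (Minimum P)
minimum {P} P? (b , pb) = go b 0 (subst P (sym (+-identityʳ b)) pb) λ _ → z≤n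
  where
  go : ∀ d m → P (d + m) → (∀ {k} → P k → m ≤ k) → ∃ (Minimum P)
  go zero    m p lb = m , p , lb
  go (suc d) m p lb with P? m
  ... | yes pm = m , pm , lb
  ... | no ¬pm = go d (suc m) (subst P (sym (+-suc d m)) p) lb′
    where
    lb′ : ∀ {k} → P k → suc m ≤ k
    lb′ pk with m≤n⇒m<n∨m≡n (lb pk)
    ... | inj₁ m<k  = m<k
    ... | inj₂ refl = ⊥-elim (¬pm pk)

Searchable : Set → Set₁
Searchable A = ∀ {P : A → Set} → Decidable P → Dec (∃ P)

anyFunction? : ∀ {A} → Searchable A → ∀ n {P : (Fin n → A) → Set} →
               (∀ {f g} → f ≗ g → P f → P g) → Decidable P → Dec (∃ P)
anyFunction? search zero resp P? =
  map′ (λ p → _ , p) (λ (_ , p) → resp (λ ()) p) (P? λ ())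
anyFunction? {A} search (suc n) {P} resp P? =
  map′ (λ (a , f , p) → _ , p)
       (λ (f , p) → f zero , f ∘ suc , resp (λ { zero → refl ; (suc _) → refl }) p)
       (search λ a → anyFunction? search n
         (λ f≗g → resp λ { zero → refl ; (suc i) → f≗g i })
         (λ f → P? (a Vector.∷ f)))

------------------------------------------------------------------------
-- Chromatic number

IsColouring : ∀ {n} → Graph n → (k : ℕ) → (Fin n → Fin k) → Set
IsColouring G k f = ∀ i j → i ~ j → f i ≢ f j
  where open Graph G

Colourable : ∀ {n} → Graph n → ℕ → Set
Colourable G k = ∃ (IsColouring G k)

colourable? : ∀ {n} (G : Graph n) → Decidable (Colourable G)
colourable? {n} G k = anyFunction? any? n
  (λ f≗g c i j i~j gi≡gj → c i j i~j (trans (f≗g i) (trans gi≡gj (sym (f≗g j)))))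
  (λ f → all? λ i → all? λ j → (i ~? j) →-dec ¬? (f i Finₚ.≟ f j))
  where open Graph G

χ-minimum : ∀ {n} (G : Graph n) → ∃ (Minimum (Colourable G))
χ-minimum {n} G = minimum (colourable? G) (n , id , λ { i _ i~i refl → ~-irrefl i~i })
  where open Graph G

χ : ∀ {n} → Graph n → ℕ
χ G = proj₁ (χ-minimum G)

------------------------------------------------------------------------
-- Path-decompositions

record IsPathDecomposition {n} (G : Graph n) {s} (bag : Fin s → Subset n) : Set where
  open Graph G
  field
    covers-vertices : ∀ v → ∃ λ t → v ∈ bag t
    covers-edges    : ∀ u v → u ~ v → ∃ λ t → u ∈ bag t × v ∈ bag t
    consecutive     : ∀ v q r t → q Fin.≤ r → r Fin.≤ t → v ∈ bag q → v ∈ bag t → v ∈ bag r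

record PathDecomposition {n} (G : Graph n) : Set where
  constructor pathDecomposition
  field
    {length} : ℕ
    bag      : Fin length → Subset n
    isPathDecomposition : IsPathDecomposition G bag
  open IsPathDecomposition isPathDecomposition public

max : ∀ {s} → (Fin s → ℕ) → ℕ
max = Vector.foldr _⊔_ 0

decompositionχ : ∀ {n} {G : Graph n} → PathDecomposition G → ℕ
decompositionχ {G = G} D = max λ t → χ (G [ bag t ])
  where open PathDecomposition D

IsDecompositionχ : ∀ {n} → Graph n → ℕ → Set
IsDecompositionχ G k = Σ (PathDecomposition G) λ D → decompositionχ D ≡ k

------------------------------------------------------------------------
-- The minimum defining χP exists: a path-decomposition with more than n
-- bags has a bag in which no vertex occurs for the last time.  Such a bag
-- can be deleted, so only finitely many bag sequences need to be searched.

max-ub : ∀ {s} (f : Fin s → ℕ) t → f t ≤ max f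
max-ub f zero    = m≤m⊔n _ _
max-ub f (suc t) = ≤-trans (max-ub (f ∘ suc) t) (m≤n⊔m (f zero) _)

max-lub : ∀ {s} (f : Fin s → ℕ) {k} → (∀ t → f t ≤ k) → max f ≤ k
max-lub {zero}  f f≤k = z≤n
max-lub {suc s} f f≤k = ⊔-lub (f≤k zero) (max-lub (f ∘ suc) (f≤k ∘ suc))

Last : ∀ {s} → (Fin s → Set) → Fin s → Set
Last P t = P t × (∀ q → P q → q Fin.≤ t)

last : ∀ {s} {P : Fin s → Set} → Decidable P → ∃ P → ∃ (Last P)
last {suc s} {P} P? p with any? (P? ∘ suc)
... | yes q = let t , pt , ub = last (P? ∘ suc) q in
  suc t , pt , λ { zero _ → z≤n ; (suc q) pq → s≤s (ub q pq) }
last {suc s} {P} P? (zero  , p) | no ¬q = zero , p , λ { zero _ → z≤n ; (suc q) pq → ⊥-elim (¬q (q , pq)) }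
last {suc s} {P} P? (suc t , p) | no ¬q = ⊥-elim (¬q (t , p))

missed : ∀ {n s} → n < s → (r : Fin n → Fin s) → ∃ λ t → ∀ v → t ≢ r v
missed n<s r with any? (λ t → all? (λ v → ¬? (t Finₚ.≟ r v)))
... | yes p = p
... | no ¬p = ⊥-elim (<⇒≱ n<s (injective⇒≤ {f = proj₁ ∘ preimage} injective))
  where
  preimage : ∀ t → ∃ λ v → t ≡ r v
  preimage t with any? (λ v → t Finₚ.≟ r v)
  ... | yes q = q
  ... | no ¬q = ⊥-elim (¬p (t , λ v e → ¬q (v , e)))
  injective : ∀ {t t′} → proj₁ (preimage t) ≡ proj₁ (preimage t′) → t ≡ t′
  injective {t} {t′} e = trans (proj₂ (preimage t)) (trans (cong r e) (sym (proj₂ (preimage t′))))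

module _ {n} (G : Graph n) where
  open Graph G

  Within : ℕ → ∀ {s} → (Fin s → Subset n) → Set
  Within k bag = IsPathDecomposition G bag × (∀ t → χ (G [ bag t ]) ≤ k)

  isPathDecomposition? : ∀ {s} (bag : Fin s → Subset n) → Dec (IsPathDecomposition G bag)
  isPathDecomposition? bag = map′
    (λ (a , b , c) → record { covers-vertices = a ; covers-edges = b ; consecutive = c })
    (λ D → let open IsPathDecomposition D in covers-vertices , covers-edges , consecutive)
    ( all? (λ v → any? λ t → v ∈? bag t)
    ×-dec all? (λ u → all? λ v → (u ~? v) →-dec any? λ t → (u ∈? bag t) ×-dec (v ∈? bag t))
    ×-dec all? (λ v → all? λ q → all? λ r → all? λ t →
      (q Finₚ.≤? r) →-dec (r Finₚ.≤? t) →-dec (v ∈? bag q) →-dec (v ∈? bag t) →-dec (v ∈? bag r)))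

  within-resp : ∀ {k s} {bag bag′ : Fin s → Subset n} → bag ≗ bag′ → Within k bag → Within k bag′
  within-resp {k} {bag = bag} {bag′} e (D , χ≤k) = D′ , λ t → subst (λ B → χ (G [ B ]) ≤ k) (e t) (χ≤k t)
    where
    open IsPathDecomposition D
    to : ∀ {v} t → v ∈ bag t → v ∈ bag′ t
    to {v} t = subst (v ∈_) (e t)
    from : ∀ {v} t → v ∈ bag′ t → v ∈ bag t
    from {v} t = subst (v ∈_) (sym (e t))
    D′ : IsPathDecomposition G bag′
    D′ = record
      { covers-vertices = λ v → let t , p = covers-vertices v in t , to t p
      ; covers-edges = λ u v u~v → let t , p , q = covers-edges u v u~v in t , to t p , to t q
      ; consecutive = λ v q r t q≤r r≤t p p′ → to r (consecutive v q r t q≤r r≤t (from q p) (from t p′))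
      }

  delete-bag : ∀ {k s} {bag : Fin (suc s) → Subset n} → n < suc s → Within k bag →
               ∃ λ (bag′ : Fin s → Subset n) → Within k bag′
  delete-bag {bag = bag} n<s (D , χ≤k) = bag ∘ punchIn d , D′ , χ≤k ∘ punchIn d
    where
    open IsPathDecomposition D
    lasts : ∀ v → ∃ (Last λ t → v ∈ bag t)
    lasts v = last (λ t → v ∈? bag t) (covers-vertices v)
    r : Fin n → Fin _
    r = proj₁ ∘ lasts
    unused : ∃ λ t → ∀ v → t ≢ r v
    unused = missed n<s r
    d : Fin _
    d = proj₁ unused
    r′ : Fin n → Fin _
    r′ v = punchOut (proj₂ unused v)
    kept : ∀ {u} v → u ∈ bag (r v) → u ∈ bag (punchIn d (r′ v))
    kept {u} v = subst (λ t → u ∈ bag t) (sym (punchIn-punchOut (proj₂ unused v)))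
    D′ : IsPathDecomposition G (bag ∘ punchIn d)
    D′ = record
      { covers-vertices = λ v → r′ v , kept v (proj₁ (proj₂ (lasts v)))
      ; covers-edges = edges
      ; consecutive = λ v q r t q≤r r≤t →
          consecutive v _ _ _ (punchIn-mono-≤ d q r q≤r) (punchIn-mono-≤ d r t r≤t)
      }
      where
      edges : ∀ u v → u ~ v → ∃ λ t → u ∈ bag (punchIn d t) × v ∈ bag (punchIn d t)
      edges u v u~v with covers-edges u v u~v | Finₚ.≤-total (r u) (r v)
      ... | t , u∈t , v∈t | inj₁ ru≤rv = r′ u , kept u (proj₁ (proj₂ (lasts u)))
                       , kept u (consecutive v t (r u) (r v) (proj₂ (proj₂ (lasts u)) t u∈t) ru≤rv v∈t (proj₁ (proj₂ (lasts v))))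
      ... | t , u∈t , v∈t | inj₂ rv≤ru = r′ v
                       , kept v (consecutive u t (r v) (r u) (proj₂ (proj₂ (lasts v)) t v∈t) rv≤ru u∈t (proj₁ (proj₂ (lasts u))))
                       , kept v (proj₁ (proj₂ (lasts v)))

  shorten : ∀ {k} s {bag : Fin s → Subset n} → Within k bag →
            ∃ λ s′ → s′ < suc n × ∃ λ (bag′ : Fin s′ → Subset n) → Within k bag′
  shorten zero    w = zero , s≤s z≤n , _ , w
  shorten (suc s) w with suc s ≤? n
  ... | yes s<n = suc s , s≤s s<n , _ , w
  ... | no  s≮n = shorten s (proj₂ (delete-bag (≰⇒> s≮n) w))

  Achievable : ℕ → Set
  Achievable k = Σ (PathDecomposition G) λ D → decompositionχ D ≤ k

  achievable? : Decidable Achievable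
  achievable? k = map′
    (λ (_ , _ , bag , D , χ≤k) → pathDecomposition bag D , max-lub _ χ≤k)
    (λ (pathDecomposition bag D , χ≤k) → shorten _ (D , λ t → ≤-trans (max-ub _ t) χ≤k))
    (anyUpTo? (λ s → anyFunction? anySubset? s within-resp
      (λ bag → isPathDecomposition? bag ×-dec all? (λ t → χ (G [ bag t ]) ≤? k)))
      (suc n))

  trivial : PathDecomposition G
  trivial = pathDecomposition {length = 1} (λ _ → ⊤) record
    { covers-vertices = λ v → zero , ∈⊤
    ; covers-edges    = λ u v _ → zero , ∈⊤ , ∈⊤
    ; consecutive     = λ v _ _ _ _ _ _ _ → ∈⊤
    }

  χP-minimum : ∃ (Minimum (IsDecompositionχ G))
  χP-minimum with minimum achievable? (_ , trivial , ≤-refl)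
  ... | m , (D , χ≤m) , lb =
    m , (D , ≤-antisym χ≤m (lb (D , ≤-refl))) , λ (D′ , e) → lb (D′ , ≤-reflexive e)

χP : ∀ {n} → Graph n → ℕ
χP G = proj₁ (χP-minimum G)

------------------------------------------------------------------------
-- Mycielski graphs

K₂ : Graph 2
K₂ = record
  { _~_ = _≢_
  ; _~?_ = λ i j → ¬? (i Finₚ.≟ j)
  ; ~-sym = λ i≢j → i≢j ∘ sym
  ; ~-irrefl = λ i≢i → i≢i refl
  }

data MycielskiVertex (n : ℕ) : Set where
  old new : Fin n → MycielskiVertex n
  apex    : MycielskiVertex n

-- Vertices are listed in the order v₁ … vₙ , w , u₁ … uₙ,
-- where vᵢ = old i , w = apex , uᵢ = new i.
vertex : ∀ {n} → Fin (n + suc n) → MycielskiVertex n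
vertex {n} i with splitAt n i
... | inj₁ j       = old j
... | inj₂ zero    = apex
... | inj₂ (suc j) = new j

-- The condition i ≢ j on the edges uᵢvⱼ is implied by irreflexivity of G.
data MycielskiAdj {n} (G : Graph n) : MycielskiVertex n → MycielskiVertex n → Set where
  vv : ∀ {i j} → Graph._~_ G i j → MycielskiAdj G (old i) (old j)
  uv : ∀ {i j} → Graph._~_ G i j → MycielskiAdj G (new i) (old j)
  vu : ∀ {i j} → Graph._~_ G i j → MycielskiAdj G (old i) (new j)
  wu : ∀ {i} → MycielskiAdj G apex (new i)
  uw : ∀ {i} → MycielskiAdj G (new i) apex

mycielskian : ∀ {n} → Graph n → Graph (n + suc n)
mycielskian {n} G = record
  { _~_      = λ i j → MycielskiAdj G (vertex i) (vertex j)
  ; _~?_     = λ i j → adj? (vertex i) (vertex j)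
  ; ~-sym    = adj-sym
  ; ~-irrefl = adj-irrefl
  }
  where
  open Graph G

  adj? : ∀ x y → Dec (MycielskiAdj G x y)
  adj? (old i) (old j) = map′ vv (λ { (vv e) → e }) (i ~? j)
  adj? (old i) (new j) = map′ vu (λ { (vu e) → e }) (i ~? j)
  adj? (old i) apex    = no λ ()
  adj? (new i) (old j) = map′ uv (λ { (uv e) → e }) (i ~? j)
  adj? (new i) (new j) = no λ ()
  adj? (new i) apex    = yes uw
  adj? apex    (old j) = no λ ()
  adj? apex    (new j) = yes wu
  adj? apex    apex    = no λ ()

  adj-sym : ∀ {x y} → MycielskiAdj G x y → MycielskiAdj G y x
  adj-sym (vv e) = vv (~-sym e)
  adj-sym (uv e) = vu (~-sym e)
  adj-sym (vu e) = uv (~-sym e)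
  adj-sym wu     = uw
  adj-sym uw     = wu

  adj-irrefl : ∀ {x} → ¬ MycielskiAdj G x x
  adj-irrefl (vv e) = ~-irrefl e

iterOrder : ℕ → ℕ
iterOrder zero    = 2
iterOrder (suc m) = iterOrder m + suc (iterOrder m)

iterMycielskian : ∀ m → Graph (iterOrder m)
iterMycielskian zero    = K₂
iterMycielskian (suc m) = mycielskian (iterMycielskian m)

-- Meaningful for k ≥ 2 only; M 0 and M 1 are junk values equal to M 2.
M : ∀ k → Graph (iterOrder (k ∸ 2))
M k = iterMycielskian (k ∸ 2)

iterOrder-closed : ∀ m → suc (iterOrder m) ≡ 3 * 2 ^ m
iterOrder-closed zero    = refl
iterOrder-closed (suc m) = begin
  suc (iterOrder m) + suc (iterOrder m) ≡⟨ cong (λ x → x + x) (iterOrder-closed m) ⟩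
  3 * 2 ^ m + 3 * 2 ^ m                 ≡⟨ solve 1 (λ x → con 3 :* x :+ con 3 :* x := con 3 :* (con 2 :* x)) refl (2 ^ m) ⟩
  3 * 2 ^ suc m                         ∎
  where
  open ≡-Reasoning
  open import Data.Nat.Solver using (module +-*-Solver)
  open +-*-Solver

order-M : ∀ k → iterOrder (k ∸ 2) ≡ 3 * 2 ^ (k ∸ 2) ∸ 1
order-M k = cong (_∸ 1) (iterOrder-closed (k ∸ 2))

-- Suppose H is a 2a+1 fold Mycielskian of a graph G on a vertices which is not
-- c-colourable, and H has a path-decomposition with c-colourable bags.  Let
-- [ l x , r x ] be the interval of bags containing x, and call q a core time of
-- x if x has neighbours y and z with r y ≤ q ≤ l z; then x lies in every bag
-- that contains one of its core times.
--
-- For each of the 2a+1 apices w let ρ w and λ w be the least right end and the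
-- greatest left end of a neighbour of w, so that the core times of w are those
-- in [ ρ w , λ w ].  One apex w₀ and two further apices for each vertex i of G
-- can be chosen, all distinct, so that ρ w₀ ≤ ρ for the first one of i and
-- λ ≤ λ w₀ for the second.  The shadow F i of i joined to precisely its two
-- apices has r ≥ ρ w₀ and l ≤ λ w₀.  If λ w₀ < ρ w₀, a bag contains all F i,
-- which is impossible.  Otherwise a core time of F i in the copy F of G is also
-- one of w₀, and Mycielski's recolouring argument at each time q separately
-- removes the colour of w₀ from the core vertices of F.  Hence passing from H to
-- G lowers by one the number of colours needed at core times, and this can
-- happen at most c times.
module Submission where

open import Defs
open import Data.Empty using (⊥-elim)
open import Data.Fin using (Fin; zero; suc; toℕ; fromℕ<; inject≤; punchIn; punchOut; _↑ˡ_; _↑ʳ_)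
open import Data.Fin.Properties as Finₚ using (splitAt-↑ˡ; splitAt-↑ʳ; punchIn-injective; punchInᵢ≢i; punchOut-injective; inject≤-injective; toℕ<n; toℕ-fromℕ<)
open import Data.Fin.Subset using (Subset; _∈_; _∉_; ⊥; ⁅_⁆; _∪_)
open import Data.Fin.Subset.Properties using (_∈?_; drop-there; ∉⊥; x∈⁅x⁆; x∈⁅y⁆⇒x≡y; x∈p∪q⁺; x∈p∪q⁻)
open import Data.List using (allFin; filter)
open import Data.List.Extrema.Nat using (argmin; argmax; argmin-all; argmax-all; f[argmin]≤f[xs]; f[xs]≤f[argmax])
open import Data.List.Membership.Propositional.Properties using (∈-allFin; ∈-filter⁺)
import Data.List.Relation.Unary.All as All
open import Data.List.Relation.Unary.All.Properties using (all-filter)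
open import Data.Nat using (ℕ; zero; suc; _+_; _≤_; _<_; _<?_; _≤?_; z≤n; s≤s)
open import Data.Nat.Properties using (≤-refl; ≤-trans; ≤-reflexive; <⇒≤; ≤-<-trans; ≰⇒>)
open import Data.Product using (∃; ∃-syntax; _×_; _,_; proj₁; proj₂)
open import Data.Sum using (_⊎_; inj₁; inj₂; [_,_]′)
open import Data.Sum.Properties using (inj₁-injective; inj₂-injective)
open import Data.Bool using (true; false)
open import Data.Unit using (⊤; tt)
open import Data.Vec using (_∷_; here; there)
open import Function using (_∘_)
open import Function.Definitions using (Injective)
open import Relation.Binary.PropositionalEquality using (_≡_; _≢_; refl; sym; trans; cong; subst; subst₂)
open import Relation.Nullary using (¬_; Dec; yes; no)
open import Relation.Unary using (Decidable)

-- Extrema and selection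

abstract
  module _ {n} {P : Fin n → Set} (P? : Decidable P) (f : Fin n → ℕ) where

    least : ∃ P → ∃ λ x → P x × (∀ y → P y → f x ≤ f y)
    least (x , p) =
        argmin f x (filter P? (allFin n))
      , argmin-all f p (all-filter P? (allFin n))
      , λ y q → All.lookup (f[argmin]≤f[xs] x _) (∈-filter⁺ P? (∈-allFin y) q)

    greatest : ∃ P → ∃ λ x → P x × (∀ y → P y → f y ≤ f x)
    greatest (x , p) =
        argmax f x (filter P? (allFin n))
      , argmax-all f p (all-filter P? (allFin n))
      , λ y q → All.lookup (f[xs]≤f[argmax] x _) (∈-filter⁺ P? (∈-allFin y) q)

  maximiser : ∀ {n} (f : Fin (suc n) → ℕ) → ∃ λ x → ∀ y → f y ≤ f x
  maximiser {n} f = argmax f zero (allFin (suc n)) ,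
    λ y → All.lookup (f[xs]≤f[argmax] {f = f} zero _) (∈-allFin y)

  -- Remove a maximum `a` times, each time passing to the complement with `punchIn`; what is left is
  -- the second block.
  split-by-size : ∀ a {b} (f : Fin (a + b) → ℕ) →
    ∃ λ (π : Fin a ⊎ Fin b → Fin (a + b)) →
      Injective _≡_ _≡_ π × (∀ i j → f (π (inj₂ j)) ≤ f (π (inj₁ i)))
  split-by-size zero f = [ (λ ()) , (λ j → j) ]′ , (λ { {inj₂ _} {inj₂ _} refl → refl }) , λ ()
  split-by-size (suc a) {b} f with maximiser f
  ... | m , f≤fm with split-by-size a (f ∘ punchIn m)
  ... | π′ , inj , below = π , π-injective , below′
    where
    π : Fin (suc a) ⊎ Fin b → Fin (suc a + b)
    π (inj₁ zero)    = m
    π (inj₁ (suc i)) = punchIn m (π′ (inj₁ i))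
    π (inj₂ j)       = punchIn m (π′ (inj₂ j))

    π-injective : Injective _≡_ _≡_ π
    π-injective {inj₁ zero}    {inj₁ zero}    e = refl
    π-injective {inj₁ zero}    {inj₁ (suc j)} e = ⊥-elim (punchInᵢ≢i m _ (sym e))
    π-injective {inj₁ zero}    {inj₂ j}       e = ⊥-elim (punchInᵢ≢i m _ (sym e))
    π-injective {inj₁ (suc i)} {inj₁ zero}    e = ⊥-elim (punchInᵢ≢i m _ e)
    π-injective {inj₂ i}       {inj₁ zero}    e = ⊥-elim (punchInᵢ≢i m _ e)
    π-injective {inj₁ (suc i)} {inj₁ (suc j)} e = cong (inj₁ ∘ suc) (inj₁-injective (inj (punchIn-injective m _ _ e)))
    π-injective {inj₂ i}       {inj₂ j}       e = cong inj₂ (inj₂-injective (inj (punchIn-injective m _ _ e)))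
    π-injective {inj₁ (suc i)} {inj₂ j}       e with inj (punchIn-injective m _ _ e)
    ... | ()
    π-injective {inj₂ i}       {inj₁ (suc j)} e with inj (punchIn-injective m _ _ e)
    ... | ()

    below′ : ∀ i j → f (π (inj₂ j)) ≤ f (π (inj₁ i))
    below′ zero    j = f≤fm _
    below′ (suc i) j = below i j

Disjoint : ∀ {n} → Subset n → Subset n → Set
Disjoint p q = ∀ x → x ∈ p → x ∉ q

-- `pivot` is the apex w₀. Each `pair i` is a `Subset` because it serves as the index of a shadow of
-- `i`.
record Selection a {n} (ρ λ′ : Fin n → ℕ) : Set where
  field
    pivot    : Fin n
    pair     : Fin a → Subset n
    disjoint : ∀ {i j} → i ≢ j → Disjoint (pair i) (pair j)
    pivot∉   : ∀ i → pivot ∉ pair i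
    upper    : ∀ i → ∃ λ s → s ∈ pair i × ρ pivot ≤ ρ s
    lower    : ∀ i → ∃ λ s → s ∈ pair i × λ′ s ≤ λ′ pivot

abstract
  -- The `a` indices with largest `ρ` are the upper partners. Among the other `a + 1`, one with
  -- greatest `λ′` is the pivot and the rest are the lower partners.
  select : ∀ a (ρ λ′ : Fin (a + suc a) → ℕ) → Selection a ρ λ′
  select a ρ λ′ with split-by-size a ρ
  ... | π , π-injective , below with maximiser (λ′ ∘ π ∘ inj₂)
  ... | m , λ′≤λ′m = record
    { pivot    = π (inj₂ m)
    ; pair     = pair
    ; disjoint = λ i≢j x x∈i x∈j → i≢j (owner-unique (owner x∈i) (owner x∈j))
    ; pivot∉   = pivot∉
    ; upper    = λ i → s i , x∈p∪q⁺ (inj₁ (x∈⁅x⁆ (s i))) , below i m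
    ; lower    = λ i → s′ i , x∈p∪q⁺ (inj₂ (x∈⁅x⁆ (s′ i))) , λ′≤λ′m (punchIn m i)
    }
    where
    s s′ : Fin a → Fin (a + suc a)
    s  i = π (inj₁ i)
    s′ i = π (inj₂ (punchIn m i))

    pair : Fin a → Subset (a + suc a)
    pair i = ⁅ s i ⁆ ∪ ⁅ s′ i ⁆

    Owner : Fin (a + suc a) → Fin a → Set
    Owner x i = x ≡ s i ⊎ x ≡ s′ i

    owner : ∀ {x i} → x ∈ pair i → Owner x i
    owner {x} {i} x∈ with x∈p∪q⁻ ⁅ s i ⁆ ⁅ s′ i ⁆ x∈
    ... | inj₁ y = inj₁ (x∈⁅y⁆⇒x≡y _ y)
    ... | inj₂ y = inj₂ (x∈⁅y⁆⇒x≡y _ y)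

    owner-unique : ∀ {x i j} → Owner x i → Owner x j → i ≡ j
    owner-unique (inj₁ refl) (inj₁ e) = inj₁-injective (π-injective e)
    owner-unique (inj₂ refl) (inj₂ e) = punchIn-injective m _ _ (inj₂-injective (π-injective e))
    owner-unique (inj₁ refl) (inj₂ e) with π-injective e
    ... | ()
    owner-unique (inj₂ refl) (inj₁ e) with π-injective e
    ... | ()

    pivot∉ : ∀ i → π (inj₂ m) ∉ pair i
    pivot∉ i m∈ with owner m∈
    ... | inj₂ e = punchInᵢ≢i m i (sym (inj₂-injective (π-injective e)))
    ... | inj₁ e with π-injective e
    ... | ()

-- Colourings

-- Colours take a membership proof, so vertices outside `P` get none and `k = 0` makes sense when
-- `P` is empty.
ColourableOn : ∀ {n} → Graph n → (Fin n → Set) → ℕ → Set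
ColourableOn G P k = ∃ λ (f : ∀ x → P x → Fin k) → ∀ x y (p : P x) (q : P y) → x ~ y → f x p ≢ f y q
  where open Graph G

module _ {m n} (G : Graph m) (H : Graph n) where
  private
    module G = Graph G
    module H = Graph H

  pullback : ∀ {P : Fin n → Set} {Q : Fin m → Set} {k} (F : Fin m → Fin n) →
             (∀ {i j} → i G.~ j → F i H.~ F j) → (∀ {i} → Q i → P (F i)) →
             ColourableOn H P k → ColourableOn G Q k
  pullback F hom Q⇒P (f , proper) =
    (λ i q → f (F i) (Q⇒P q)) , λ i j p q i~j → proper _ _ _ _ (hom i~j)

  -- If `F i` has the colour of `w`, it takes that of `F⁺ i`, which differs as `w ~ F⁺ i`. Adjacent
  -- `i`, `j` are not both changed, and `F⁺ i ~ F j` settles the case of one change. Then `punchOut`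
  -- drops the colour of `w`.
  recolour : ∀ {P : Fin n → Set} {Q : Fin m → Set} {k} (F F⁺ : Fin m → Fin n) (w : Fin n) →
             (∀ {i j} → i G.~ j → F i H.~ F j) → (∀ {i j} → i G.~ j → F⁺ i H.~ F j) →
             (∀ i → w H.~ F⁺ i) →
             (∀ {i} → Q i → P (F i)) → (∀ {i} → Q i → P (F⁺ i)) → P w →
             ColourableOn H P (suc k) → ColourableOn G Q k
  recolour {P} {Q} {k} F F⁺ w hom hom⁺ w~F⁺ toF toF⁺ pw (f , proper) =
    (λ i q → g i q (f (F i) (toF q) Finₚ.≟ f w pw)) ,
    λ i j p q i~j → g-proper i j p q i~j (f (F i) (toF p) Finₚ.≟ f w pw) (f (F j) (toF q) Finₚ.≟ f w pw)
    where
    w≢F⁺ : ∀ {i} (q : Q i) → f w pw ≢ f (F⁺ i) (toF⁺ q)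
    w≢F⁺ q = proper _ _ pw (toF⁺ q) (w~F⁺ _)

    g : ∀ i (q : Q i) → Dec (f (F i) (toF q) ≡ f w pw) → Fin k
    g i q (yes _) = punchOut (w≢F⁺ q)
    g i q (no ≢w) = punchOut (≢w ∘ sym)

    g-proper : ∀ i j (p : Q i) (q : Q j) → i G.~ j → ∀ d e → g i p d ≢ g j q e
    g-proper i j p q i~j (yes d) (yes e) eq = proper _ _ _ _ (hom i~j) (trans d (sym e))
    g-proper i j p q i~j (yes d) (no e)  eq = proper _ _ _ _ (hom⁺ i~j) (punchOut-injective (w≢F⁺ p) (e ∘ sym) eq)
    g-proper i j p q i~j (no d)  (yes e) eq = proper _ _ _ _ (hom⁺ (G.~-sym i~j)) (punchOut-injective (w≢F⁺ q) (d ∘ sym) (sym eq))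
    g-proper i j p q i~j (no d)  (no e)  eq = proper _ _ _ _ (hom i~j) (punchOut-injective (d ∘ sym) (e ∘ sym) eq)

module _ {n} (G : Graph n) where

  colourableOn⇒colourable : ∀ {P : Fin n → Set} {k} → (∀ x → P x) → ColourableOn G P k → Colourable G k
  colourableOn⇒colourable p (f , proper) = (λ x → f x (p x)) , λ x y → proper x y (p x) (p y)

  colourable⇒colourableOn : ∀ {P : Fin n → Set} {k} → Colourable G k → ColourableOn G P k
  colourable⇒colourableOn (f , proper) = (λ x _ → f x) , λ x y _ _ → proper x y

  colourableOn-empty : ∀ {P : Fin n → Set} {k} → (∀ x → ¬ P x) → ColourableOn G P k
  colourableOn-empty ¬p = (λ x p → ⊥-elim (¬p x p)) , λ x _ p → ⊥-elim (¬p x p)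

-- Shadows of a graph in its iterated Mycielskians

module _ {n : ℕ} where

  encode : MycielskiVertex n → Fin (n + suc n)
  encode (old i) = i ↑ˡ suc n
  encode apex    = n ↑ʳ zero
  encode (new i) = n ↑ʳ suc i

  vertex-encode : ∀ x → vertex (encode x) ≡ x
  vertex-encode (old i) rewrite splitAt-↑ˡ n i (suc n) = refl
  vertex-encode apex    rewrite splitAt-↑ʳ n (suc n) zero = refl
  vertex-encode (new i) rewrite splitAt-↑ʳ n (suc n) (suc i) = refl

  encode-adj : ∀ (G : Graph n) {x y} → MycielskiAdj G x y → Graph._~_ (mycielskian G) (encode x) (encode y)
  encode-adj G {x} {y} = subst₂ (MycielskiAdj G) (sym (vertex-encode x)) (sym (vertex-encode y))

-- A shadow of i in the N-fold Mycielskian is indexed by the set of steps at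
-- which it is taken to be a new vertex.
record Shadows (N : ℕ) {m n} (G : Graph m) (H : Graph n) : Set where
  private
    module G = Graph G
    module H = Graph H
  field
    shadow      : Subset N → Fin m → Fin n
    apices      : Fin N → Fin n
    shadow-adj  : ∀ {σ τ i j} → Disjoint σ τ → i G.~ j → shadow σ i H.~ shadow τ j
    apex-adj    : ∀ {s σ} i → s ∈ σ → apices s H.~ shadow σ i

shadows₀ : ∀ {m} {G : Graph m} → Shadows 0 G G
shadows₀ = record
  { shadow     = λ _ i → i
  ; apices     = λ ()
  ; shadow-adj = λ _ e → e
  ; apex-adj   = λ { {()} }
  }

shadows-suc : ∀ {N m n} {G : Graph m} {H : Graph n} → Shadows N G H → Shadows (suc N) G (mycielskian H)
shadows-suc {N} {m} {n} {G} {H} S = record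
  { shadow     = λ σ i → encode (sh σ i)
  ; apices     = λ s → encode (ap s)
  ; shadow-adj = λ {σ} {τ} d e → encode-adj H (sh-adj σ τ d e)
  ; apex-adj   = λ {s} {σ} i s∈σ → encode-adj H (ap-adj s σ i s∈σ)
  }
  where
  open Shadows S
  sh : Subset (suc N) → Fin m → MycielskiVertex n
  sh (true  ∷ σ) i = new (shadow σ i)
  sh (false ∷ σ) i = old (shadow σ i)

  ap : Fin (suc N) → MycielskiVertex n
  ap zero    = apex
  ap (suc s) = old (apices s)

  sh-adj : ∀ σ τ {i j} → Disjoint σ τ → Graph._~_ G i j → MycielskiAdj H (sh σ i) (sh τ j)
  -- New vertices are never adjacent to each other; disjointness excludes this case.
  sh-adj (true  ∷ σ) (true  ∷ τ) d e = ⊥-elim (d zero here here)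
  sh-adj (true  ∷ σ) (false ∷ τ) d e = uv (shadow-adj (λ x p q → d (suc x) (there p) (there q)) e)
  sh-adj (false ∷ σ) (true  ∷ τ) d e = vu (shadow-adj (λ x p q → d (suc x) (there p) (there q)) e)
  sh-adj (false ∷ σ) (false ∷ τ) d e = vv (shadow-adj (λ x p q → d (suc x) (there p) (there q)) e)

  ap-adj : ∀ s σ i → s ∈ σ → MycielskiAdj H (ap s) (sh σ i)
  ap-adj zero    (true  ∷ σ) i s∈σ = wu
  ap-adj (suc s) (true  ∷ σ) i s∈σ = vu (apex-adj i (drop-there s∈σ))
  ap-adj (suc s) (false ∷ σ) i s∈σ = vv (apex-adj i (drop-there s∈σ))

iterShadows : ∀ N m → Shadows N (iterMycielskian m) (iterMycielskian (N + m))
iterShadows zero    m = shadows₀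
iterShadows (suc N) m = shadows-suc (iterShadows N m)

-- The shadows with index `⊥`, old at every step, form a copy of `G` in `H`.
shadows-colourable : ∀ {N m n c} {G : Graph m} {H : Graph n} → Shadows N G H → Colourable H c → Colourable G c
shadows-colourable S (f , proper) = f ∘ shadow ⊥ , λ i j i~j → proper _ _ (shadow-adj (λ _ p _ → ∉⊥ p) i~j)
  where open Shadows S

mycielskian-colourable : ∀ {n k} {G : Graph n} → Colourable (mycielskian G) (suc k) → Colourable G k
mycielskian-colourable {G = G} col = colourableOn⇒colourable G {P = λ _ → ⊤} (λ _ → tt)
  (recolour G (mycielskian G) {P = λ _ → ⊤} (encode ∘ old) (encode ∘ new) (encode apex)
    (encode-adj G ∘ vv) (encode-adj G ∘ uv) (λ _ → encode-adj G wu)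
    (λ q → q) (λ q → q) tt (colourable⇒colourableOn (mycielskian G) col))

iterMycielskian-uncolourable : ∀ m → ¬ Colourable (iterMycielskian m) (suc m)
iterMycielskian-uncolourable zero (f , proper) with f zero in p | f (suc zero) in q
... | zero | zero = proper zero (suc zero) (λ ()) (trans p (sym q))
iterMycielskian-uncolourable (suc m) col = iterMycielskian-uncolourable m (mycielskian-colourable col)

-- Interval representations

-- Symmetry of `~` makes `meet` two-sided. `Core` refers to neighbours of `x` only, never to `l x`
-- or `r x`, so another vertex with the same relevant neighbours inherits it.
record Representation (c k : ℕ) {n} (G : Graph n) : Set where
  open Graph G
  field
    l r  : Fin n → ℕ
    meet : ∀ {x y} → x ~ y → l x ≤ r y

  Bag : ℕ → Fin n → Set
  Bag q x = l x ≤ q × q ≤ r x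

  Core : ℕ → Fin n → Set
  Core q x = (∃ λ y → x ~ y × r y ≤ q) × (∃ λ z → x ~ z × q ≤ l z)

  field
    bag-colouring  : ∀ q → ColourableOn G (Bag q) c
    core-colouring : ∀ q → ColourableOn G (Core q) k

-- Descent from an iterated Mycielskian to the original graph

module _ {a c k n} {G : Graph a} {H : Graph n} (S : Shadows (a + suc a) G H)
         (uncolourable : ¬ Colourable G c) (R : Representation c k H) where
  open Shadows S
  open Representation R
  private
    module G = Graph G
    module H = Graph H
    N = a + suc a

    -- The empty graph is `c`-colourable, so `G` has a vertex, and hence every apex has a neighbour.
    anyVertex : Fin a
    anyVertex with Finₚ.any? (λ (_ : Fin a) → yes tt)
    ... | yes (i , _) = i
    ... | no ¬i       = ⊥-elim (uncolourable (⊥-elim ∘ ¬i ∘ (_, tt) , λ i → ⊥-elim (¬i (i , tt))))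

    apex-neighbour : ∀ s → ∃ λ y → apices s H.~ y
    apex-neighbour s = shadow ⁅ s ⁆ anyVertex , apex-adj anyVertex (x∈⁅x⁆ s)

    leftmost : ∀ s → ∃ λ y → apices s H.~ y × (∀ z → apices s H.~ z → r y ≤ r z)
    leftmost s = least (apices s H.~?_) r (apex-neighbour s)

    rightmost : ∀ s → ∃ λ y → apices s H.~ y × (∀ z → apices s H.~ z → l z ≤ l y)
    rightmost s = greatest (apices s H.~?_) l (apex-neighbour s)

    ρ λ′ : Fin N → ℕ
    ρ  s = r (proj₁ (leftmost s))
    λ′ s = l (proj₁ (rightmost s))

    apex-core : ∀ {q} s → ρ s ≤ q → q ≤ λ′ s → Core q (apices s)
    apex-core s ρ≤q q≤λ =
      (_ , proj₁ (proj₂ (leftmost s)) , ρ≤q) , (_ , proj₁ (proj₂ (rightmost s)) , q≤λ)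

    open Selection (select a ρ λ′)

    -- `F⁺ i` is the twin of `F i` that also sees the pivot apex. As the pivot lies in no pair,
    -- `F⁺ i` keeps the adjacencies to the copy `F`.
    F F⁺ : Fin a → Fin n
    F  i = shadow (pair i) i
    F⁺ i = shadow (⁅ pivot ⁆ ∪ pair i) i

    pairs-disjoint : ∀ {i j} → i G.~ j → Disjoint (pair i) (pair j)
    pairs-disjoint i~j = disjoint λ { refl → G.~-irrefl i~j }

    F-adj : ∀ {i j} → i G.~ j → F i H.~ F j
    F-adj i~j = shadow-adj (pairs-disjoint i~j) i~j

    F⁺-adj : ∀ {i j} → i G.~ j → F⁺ i H.~ F j
    F⁺-adj {i} {j} i~j = shadow-adj dis i~j
      where
      dis : Disjoint (⁅ pivot ⁆ ∪ pair i) (pair j)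
      dis x x∈ x∈j with x∈p∪q⁻ ⁅ pivot ⁆ (pair i) x∈
      ... | inj₁ x∈⁅⁆ = pivot∉ j (subst (_∈ pair j) (x∈⁅y⁆⇒x≡y _ x∈⁅⁆) x∈j)
      ... | inj₂ x∈i  = pairs-disjoint i~j x x∈i x∈j

    ρ≤r : ∀ i → ρ pivot ≤ r (F i)
    ρ≤r i = let s , s∈ , ρ≤ρs = upper i in ≤-trans ρ≤ρs (proj₂ (proj₂ (leftmost s)) _ (apex-adj i s∈))

    l≤λ : ∀ i → l (F i) ≤ λ′ pivot
    l≤λ i = let s , s∈ , λs≤λ = lower i in ≤-trans (proj₂ (proj₂ (rightmost s)) _ (apex-adj i s∈)) λs≤λ

    -- This is `Core` for the representation of `G` with ends `l ∘ F` and `r ∘ F`.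
    CopyCore : ℕ → Fin a → Set
    CopyCore q i = (∃ λ j → i G.~ j × r (F j) ≤ q) × (∃ λ j → i G.~ j × q ≤ l (F j))

    between : ∀ {q i} → CopyCore q i → ρ pivot ≤ q × q ≤ λ′ pivot
    between ((x , _ , rx≤q) , (y , _ , q≤ly)) = ≤-trans (ρ≤r x) rx≤q , ≤-trans q≤ly (l≤λ y)

    core-transfer : ∀ {q i} (v : Fin n) → (∀ {j} → i G.~ j → v H.~ F j) → CopyCore q i → Core q v
    core-transfer v adj ((x , i~x , rx≤q) , (y , i~y , q≤ly)) = (F x , adj i~x , rx≤q) , (F y , adj i~y , q≤ly)

    -- Otherwise `l (F i) ≤ λ′ pivot < ρ pivot ≤ r (F i)` for all `i`, and the bag at time `ρ pivot`
    -- would yield a `c`-colouring of `G`.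
    ρ≤λ : ρ pivot ≤ λ′ pivot
    ρ≤λ with ρ pivot ≤? λ′ pivot
    ... | yes p = p
    ... | no ¬p = ⊥-elim (uncolourable (colourableOn⇒colourable G
      (λ i → ≤-trans (l≤λ i) (<⇒≤ (≰⇒> ¬p)) , ρ≤r i)
      (pullback G H F F-adj (λ b → b) (bag-colouring (ρ pivot)))))

  descend : ∃ λ k′ → k ≡ suc k′ × Representation c k′ G
  descend = lower-colours k core-colouring
    where
    lower-colours : ∀ k → (∀ q → ColourableOn H (Core q) k) → ∃ λ k′ → k ≡ suc k′ × Representation c k′ G
    -- The pivot apex is a core vertex at time `ρ pivot`, so at least one colour exists.
    lower-colours zero col with proj₁ (col (ρ pivot)) _ (apex-core pivot ≤-refl ρ≤λ)
    ... | ()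
    lower-colours (suc k′) col = k′ , refl , record
      { l              = l ∘ F
      ; r              = r ∘ F
      ; meet           = meet ∘ F-adj
      ; bag-colouring  = λ q → pullback G H F F-adj (λ b → b) (bag-colouring q)
      ; core-colouring = λ q → recolour-core q (col q)
      }
      where
      recolour-core : ∀ q → ColourableOn H (Core q) (suc k′) → ColourableOn G (CopyCore q) k′
      recolour-core q col with ρ pivot ≤? q | q ≤? λ′ pivot
      ... | yes ρ≤q | yes q≤λ =
        recolour G H F F⁺ (apices pivot) F-adj F⁺-adj (λ i → apex-adj i (x∈p∪q⁺ (inj₁ (x∈⁅x⁆ pivot))))
          (core-transfer _ F-adj) (core-transfer _ F⁺-adj) (apex-core pivot ρ≤q q≤λ) col
      -- At times when the pivot apex is not known to be core, the copy has no core vertex at all.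
      ... | no ρ≰q | _      = colourableOn-empty G λ i p → ρ≰q (proj₁ (between p))
      ... | yes _  | no q≰λ = colourableOn-empty G λ i p → q≰λ (proj₂ (between p))

-- Induction on `k`, one `descend` per step. Uncolourability is carried along because `descend`
-- requires it of the smaller graph.
unrepresentable : ∀ c → 1 ≤ c → ∀ k → ∃ λ m →
  ¬ Colourable (iterMycielskian m) c × ¬ Representation c k (iterMycielskian m)
unrepresentable (suc c) 1≤c k = go k
  where
  step : ∀ m k → ¬ Colourable (iterMycielskian m) (suc c) →
         (∀ k′ → k ≡ suc k′ → ¬ Representation (suc c) k′ (iterMycielskian m)) →
         ∃ λ m′ → ¬ Colourable (iterMycielskian m′) (suc c) × ¬ Representation (suc c) k (iterMycielskian m′)
  step m k uncol unrep = N + m , uncol ∘ shadows-colourable S , λ R →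
    let k′ , k≡ , R′ = descend S uncol R in unrep k′ k≡ R′
    where
    N = iterOrder m + suc (iterOrder m)
    S = iterShadows N m

  go : ∀ k → ∃ λ m → ¬ Colourable (iterMycielskian m) (suc c) × ¬ Representation (suc c) k (iterMycielskian m)
  -- Even `k = 0` takes one descent, whose conclusion `0 ≡ suc k′` is absurd.
  go zero    = step c zero (iterMycielskian-uncolourable c) λ _ ()
  go (suc k) = let m , uncol , unrep = go k in step m (suc k) uncol λ { _ refl → unrep }

-- Path-decompositions as interval representations

element-surjective : ∀ {n} {B : Subset n} {x} → x ∈ B → ∃ λ i → element B i ≡ x
element-surjective here = zero , refl
element-surjective {B = true  ∷ B} (there x∈B) = let i , e = element-surjective x∈B in suc i , cong suc e
element-surjective {B = false ∷ B} (there x∈B) = let i , e = element-surjective x∈B in i , cong suc e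

induced-colouring : ∀ {n} (G : Graph n) {B k} → Colourable (G [ B ]) k → ColourableOn G (_∈ B) k
induced-colouring G {B} (f , proper) =
  (λ x x∈B → f (proj₁ (element-surjective x∈B))) ,
  λ x y x∈B y∈B x~y → proper _ _
    (subst₂ (Graph._~_ G) (sym (proj₂ (element-surjective x∈B))) (sym (proj₂ (element-surjective y∈B))) x~y)

colourable-χ : ∀ {n c} (G : Graph n) → χ G ≤ c → Colourable G c
colourable-χ G χ≤c = let f , proper = proj₁ (proj₂ (χ-minimum G)) in
  (λ x → inject≤ (f x) χ≤c) , λ x y x~y → proper x y x~y ∘ inject≤-injective χ≤c χ≤c (f x) (f y)

module _ {n c} {G : Graph n} (D : PathDecomposition G) (D≤c : decompositionχ D ≤ c) where
  open PathDecomposition D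
  open Graph G
  private
    firstBag : ∀ x → ∃ λ t → x ∈ bag t × (∀ t′ → x ∈ bag t′ → toℕ t ≤ toℕ t′)
    firstBag x = least (λ t → x ∈? bag t) toℕ (covers-vertices x)

    lastBag : ∀ x → ∃ λ t → x ∈ bag t × (∀ t′ → x ∈ bag t′ → toℕ t′ ≤ toℕ t)
    lastBag x = greatest (λ t → x ∈? bag t) toℕ (covers-vertices x)

    first last′ : Fin n → ℕ
    first x = toℕ (proj₁ (firstBag x))
    last′ x = toℕ (proj₁ (lastBag x))

    Active : ℕ → Fin n → Set
    Active q x = first x ≤ q × q ≤ last′ x

    active⇒∈ : ∀ {x} t → Active (toℕ t) x → x ∈ bag t
    active⇒∈ {x} t (f≤t , t≤l) =
      consecutive x _ t _ f≤t t≤l (proj₁ (proj₂ (firstBag x))) (proj₁ (proj₂ (lastBag x)))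

    active-colouring : ∀ q → ColourableOn G (Active q) c
    active-colouring q with q <? length
    -- Past the last bag no vertex is active.
    ... | no q≮s = colourableOn-empty G λ x (_ , q≤l) → q≮s (≤-<-trans q≤l (toℕ<n _))
    ... | yes q<s = pullback G G (λ x → x) (λ e → e)
      (λ {x} a → active⇒∈ t (subst (λ q → Active q x) (sym (toℕ-fromℕ< q<s)) a))
      (induced-colouring G (colourable-χ (G [ bag t ]) (≤-trans (max-ub _ t) D≤c)))
      where t = fromℕ< q<s

    meet : ∀ {x y} → x ~ y → first x ≤ last′ y
    meet {x} {y} x~y = let t , x∈t , y∈t = covers-edges x y x~y in
      ≤-trans (proj₂ (proj₂ (firstBag x)) t x∈t) (proj₂ (proj₂ (lastBag y)) t y∈t)

  representation : Representation c c G
  representation = record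
    { l = first ; r = last′ ; meet = meet
    ; bag-colouring = active-colouring
    -- Core times are bag times: `l x ≤ r y ≤ q ≤ l z ≤ r x`. So the bag colourings serve, and the
    -- descent can start with `k = c`.
    ; core-colouring = λ q → pullback G G (λ x → x) (λ e → e)
        (λ { ((y , x~y , ry≤q) , (z , x~z , q≤lz)) → ≤-trans (meet x~y) ry≤q , ≤-trans q≤lz (meet (~-sym x~z)) })
        (active-colouring q)
    }

corollary1p5 : ∀ (c : ℕ) → 1 ≤ c → ∃[ n ] (2 ≤ n × c < χP (M n))
corollary1p5 c 1≤c = let m , _ , unrep = unrepresentable c 1≤c c in
  -- The shift by two is that between `M` and `iterMycielskian`, which starts from `K₂` at 0.
  suc (suc m) , s≤s (s≤s z≤n) , ≰⇒> λ χP≤c →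
    let D , e = proj₁ (proj₂ (χP-minimum (iterMycielskian m))) in
    unrep (representation D (≤-trans (≤-reflexive e) χP≤c))
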